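{- Let $A$ be a set, let $Q,R$ be predicates on $A$, and let $S$ be a binary relation on $A$. Let $wp(S,Q)$ and $wp(S,R)$ be the weakest preconditions of $S$ with respect to the postconditions $Q$ and $R$. Then $$\forall x\,(Q(x)\Rightarrow R(x))\ \Rightarrow\ \forall x\,\big(wp(S,Q)(x)\Rightarrow wp(S,R)(x)\big).$$
   Context: $A$ is an arbitrary set (the abstract state space); all quantified variables range over $A$. An $S$-predicate is a predicate $P:A\to\{\top,\bot\}$; an $S$-relation is an arbitrary binary relation $S\subseteq A\times A$, with $S(x,y)$ meaning $(x,y)\in S$ (neither totality nor determinism is assumed). The total correctness formula $\{P\}S\{Q\}$ abbreviates $$\forall x\,[P(x)\Rightarrow(\exists y\,S(x,y)\ \land\ \forall z\,(S(x,z)\Rightarrow Q(z)))].$$ The weakest precondition of $S$ with respect to a postcondition $Q$ is an $S$-predicate $wp(S,Q)$ such that: (WP1) $\{wp(S,Q)\}S\{Q\}$; and (WP2) for every $S$-predicate $P$, $\{P\}S\{Q\}\Rightarrow\forall x\,(P(x)\Rightarrow wp(S,Q)(x))$. The logic is classical first-order predicate logic. -}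

module Defs where

open import Level using (Level; suc)
open import Data.Product using (_×_; ∃-syntax)
open import Relation.Unary using (Pred)
open import Relation.Binary.Core using (Rel)

private
  variable
    ℓ : Level

-- Total correctness, {P} S {Q} in the usual notation; braces are reserved in Agda.
⟪_⟫_⟪_⟫ : {A : Set ℓ} → Pred A ℓ → Rel A ℓ → Pred A ℓ → Set ℓ
⟪ P ⟫ S ⟪ Q ⟫ = ∀ x → P x → (∃[ y ] S x y) × (∀ z → S x z → Q z)

-- The carrier, predicates and relations share one universe level ℓ so that the
-- predicates ranged over by `weakest` include those defined by quantifying
-- over states; in particular a weakest precondition exists at this level.
record IsWeakestPrecondition {A : Set ℓ} (S : Rel A ℓ) (Q W : Pred A ℓ)
       : Set (suc ℓ) where
  field
    precondition : ⟪ W ⟫ S ⟪ Q ⟫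
    weakest      : (P : Pred A ℓ) → ⟪ P ⟫ S ⟪ Q ⟫ → ∀ x → P x → W x

{-# OPTIONS --safe #-}
module Submission where

open import Level using (Level)
open import Data.Product using (map₂)
open import Relation.Unary using (Pred)
open import Relation.Binary.Core using (Rel)
open import Defs

open IsWeakestPrecondition

-- Total correctness is monotone in the postcondition, so `wpQ`, a precondition for `Q`, is also one
-- for `R`; maximality of `wpR` among those then gives the implication.

weaken-postcondition : ∀ {ℓ : Level} {A : Set ℓ} {P Q R : Pred A ℓ} {S : Rel A ℓ} →
    (∀ x → Q x → R x) → ⟪ P ⟫ S ⟪ Q ⟫ → ⟪ P ⟫ S ⟪ R ⟫
-- The existence of a successor does not involve the postcondition, so only the second component
-- changes.
weaken-postcondition Q⇒R PSQ x Px = map₂ (λ post z Sxz → Q⇒R z (post z Sxz)) (PSQ x Px)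

theorem5p2 : ∀ {ℓ : Level} (A : Set ℓ) (Q R : Pred A ℓ) (S : Rel A ℓ)
    (wpQ wpR : Pred A ℓ) →
    IsWeakestPrecondition S Q wpQ →
    IsWeakestPrecondition S R wpR →
    (∀ x → Q x → R x) →
    ∀ x → wpQ x → wpR x
theorem5p2 A Q R S wpQ wpR isWpQ isWpR Q⇒R =
  -- `wpQ` itself is the candidate precondition compared with `wpR`.
  weakest isWpR wpQ (weaken-postcondition Q⇒R (precondition isWpQ))
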